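{- Let $\mathcal{A}$ and $\mathcal{S}$ be Sudoku grids. If $\theta$ is an automorphism of $\mathcal{A}$ and $\mathcal{S}$ is the unique solution of $\mathcal{A}$, then $\theta$ is an automorphism of $\mathcal{S}$.
   Context: A grid is a $9\times 9$ matrix $\mathcal{A}=[A_{ij}]_{9\times 9}$ of nonempty subsets $A_{ij}\subseteq\{1,\dots,9\}$; it is full if $|A_{ij}|=1$ for all $i,j$. A Sudoku grid is a grid such that whenever $A_{ij}=\{d\}$, the digit $d$ belongs to no $A_{\ell m}$ for any other cell $(\ell,m)\ne(i,j)$ in the same row, column or (standard $3\times 3$) box. A solution of a Sudoku grid $\mathcal{A}=[A_{ij}]$ is a full Sudoku grid $\mathcal{S}=[S_{ij}]$ with $S_{ij}\subseteq A_{ij}$ for all $i,j$. Elementary Sudoku transformations are the following maps from Sudoku grids to Sudoku grids. Geometric transformations: the identity $\mathrm{id}$; $\delta$, where $\delta(\mathcal{A})_{ij}=A_{ji}$; $\chi$, where $\chi(\mathcal{A})_{ij}=A_{10-i,j}$; $\overline\chi=\delta\circ\chi\circ\delta$; $\overline\delta=\overline\chi\circ\delta\circ\overline\chi$; $\rho_1=\delta\circ\chi$; $\rho_2=\rho_1\circ\rho_1$; $\rho_3=\rho_1\circ\rho_1\circ\rho_1$. Shuffles: for a bijection $f$ of $\{1,\dots,9\}$ respecting the partition $\{\{1,2,3\},\{4,5,6\},\{7,8,9\}\}$ (i.e. $i,j$ lie in the same block iff $f(i),f(j)$ do), the row shuffle $\sigma_f(\mathcal{A})_{ij}=A_{f(i)\,j}$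 and the column shuffle $\tau_f(\mathcal{A})_{ij}=A_{i\,f(j)}$. Relabellings: for any bijection $f$ of $\{1,\dots,9\}$, $\lambda_f(\mathcal{A})_{ij}=\{f(d):d\in A_{ij}\}$. A Sudoku transformation is any finite composition of elementary Sudoku transformations. A Sudoku transformation $\theta$ is an automorphism of a Sudoku grid $\mathcal{A}$ if $\theta(\mathcal{A})=\mathcal{A}$. -}

module Defs where

open import Data.Fin.Base using (Fin; opposite; quotient)
open import Data.Fin.Permutation using (Permutation′; _⟨$⟩ʳ_; _⟨$⟩ˡ_; inverseˡ; inverseʳ)
open import Data.Fin.Properties using (_≟_; all?; opposite-involutive)
open import Data.Fin.Subset using (Subset; _∈_; _∉_; _⊆_; Nonempty; ∣_∣; ⁅_⁆)
open import Data.Fin.Subset.Properties using (⊆-antisym; x∈⁅x⁆; x∈⁅y⁆⇒x≡y)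
open import Data.Product.Base using (_×_; _,_; ∃; proj₁; proj₂)
open import Data.Sum.Base using (_⊎_; inj₁; inj₂)
open import Data.Vec.Base using (lookup; tabulate)
open import Data.Vec.Properties using ([]=⇒lookup; lookup⇒[]=; lookup∘tabulate)
open import Function.Base using (id; _∘_)
open import Function.Bundles using (_⇔_; mk⇔; Equivalence)
open import Relation.Binary.PropositionalEquality
  using (_≡_; _≢_; refl; sym; trans; cong; cong₂; subst)
open import Relation.Nullary.Decidable using (from-yes)

-- Digits and row and column indices are zero-based: k : Fin 9 stands for k + 1.

Cell : Set
Cell = Fin 9 × Fin 9

-- The class of an index in the partition {0,1,2}, {3,4,5}, {6,7,8}.
block : Fin 9 → Fin 3
block = quotient {3} 3

SameRow SameColumn SameBox : Cell → Cell → Set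
SameRow    (i , j) (l , m) = i ≡ l
SameColumn (i , j) (l , m) = j ≡ m
SameBox    (i , j) (l , m) = block i ≡ block l × block j ≡ block m

SharesUnit : Cell → Cell → Set
SharesUnit c c′ = SameRow c c′ ⊎ SameColumn c c′ ⊎ SameBox c c′

record Grid : Set where
  field
    entry    : Fin 9 → Fin 9 → Subset 9
    nonempty : ∀ i j → Nonempty (entry i j)

open Grid public

IsFull : Grid → Set
IsFull A = ∀ i j → ∣ entry A i j ∣ ≡ 1

IsSudoku : Grid → Set
IsSudoku A = ∀ i j d → entry A i j ≡ ⁅ d ⁆ →
             ∀ l m → (l , m) ≢ (i , j) → SharesUnit (l , m) (i , j) →
             d ∉ entry A l m

record SudokuGrid : Set where
  field
    grid     : Grid
    isSudoku : IsSudoku grid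

open SudokuGrid public

cell : SudokuGrid → Fin 9 → Fin 9 → Subset 9
cell A = entry (grid A)

-- Equality of matrices. The proof components of the records are irrelevant to it.
infix 4 _≋_
_≋_ : SudokuGrid → SudokuGrid → Set
A ≋ B = ∀ i j → cell A i j ≡ cell B i j

IsSolution : SudokuGrid → SudokuGrid → Set
IsSolution A S = IsFull (grid S) × (∀ i j → cell S i j ⊆ cell A i j)

IsUniqueSolution : SudokuGrid → SudokuGrid → Set
IsUniqueSolution A S = IsSolution A S × (∀ T → IsSolution A T → T ≋ S)

-- reindex g has at (i , j) the entry of the given grid at g (i , j).
reindex : (g : Cell → Cell) →
          (∀ {c c′} → g c ≡ g c′ → c ≡ c′) →
          (∀ {c c′} → SharesUnit c c′ → SharesUnit (g c) (g c′)) →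
          SudokuGrid → SudokuGrid
reindex g inj pres A = record
  { grid = record
      { entry    = λ i j → cell A (proj₁ (g (i , j))) (proj₂ (g (i , j)))
      ; nonempty = λ i j → nonempty (grid A) _ _
      }
  ; isSudoku = λ i j d e l m ne u →
      isSudoku A _ _ d e _ _ (λ eq → ne (inj eq)) (pres u)
  }

δ : SudokuGrid → SudokuGrid
δ = reindex (λ (i , j) → (j , i))
  (λ { refl → refl })
  (λ { (inj₁ p)              → inj₂ (inj₁ p)
     ; (inj₂ (inj₁ p))       → inj₁ p
     ; (inj₂ (inj₂ (p , q))) → inj₂ (inj₂ (q , p)) })

-- Acting on the row index by an injection compatible with the blocks.
onRows : (h : Fin 9 → Fin 9) →
         (∀ {i l} → h i ≡ h l → i ≡ l) →
         (∀ {i l} → block i ≡ block l → block (h i) ≡ block (h l)) →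
         SudokuGrid → SudokuGrid
onRows h inj pres = reindex (λ (i , j) → (h i , j))
  (λ e → cong₂ _,_ (inj (cong proj₁ e)) (cong proj₂ e))
  (λ { (inj₁ p)              → inj₁ (cong h p)
     ; (inj₂ (inj₁ p))       → inj₂ (inj₁ p)
     ; (inj₂ (inj₂ (p , q))) → inj₂ (inj₂ (pres p , q)) })

onColumns : (h : Fin 9 → Fin 9) →
            (∀ {j m} → h j ≡ h m → j ≡ m) →
            (∀ {j m} → block j ≡ block m → block (h j) ≡ block (h m)) →
            SudokuGrid → SudokuGrid
onColumns h inj pres = reindex (λ (i , j) → (i , h j))
  (λ e → cong₂ _,_ (cong proj₁ e) (inj (cong proj₂ e)))
  (λ { (inj₁ p)              → inj₁ p
     ; (inj₂ (inj₁ p))       → inj₂ (inj₁ (cong h p))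
     ; (inj₂ (inj₂ (p , q))) → inj₂ (inj₂ (p , pres q)) })

block-opposite : ∀ i → block (opposite i) ≡ opposite (block i)
block-opposite = from-yes (all? λ i → block (opposite i) ≟ opposite (block i))

-- In zero-based indices, opposite i is the index written 10 - i in one-based ones.
χ : SudokuGrid → SudokuGrid
χ = onRows opposite
  (λ {i} {l} e → trans (sym (opposite-involutive i))
                       (trans (cong opposite e) (opposite-involutive l)))
  (λ {i} {l} e → trans (block-opposite i)
                       (trans (cong opposite e) (sym (block-opposite l))))

χ̄ δ̄ ρ₁ ρ₂ ρ₃ : SudokuGrid → SudokuGrid
χ̄  = δ ∘ χ ∘ δ
δ̄  = χ̄ ∘ δ ∘ χ̄
ρ₁ = δ ∘ χ
ρ₂ = ρ₁ ∘ ρ₁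
ρ₃ = ρ₁ ∘ ρ₁ ∘ ρ₁

RespectsBlocks : Permutation′ 9 → Set
RespectsBlocks f = ∀ i j → (block i ≡ block j) ⇔ (block (f ⟨$⟩ʳ i) ≡ block (f ⟨$⟩ʳ j))

perm-injective : (f : Permutation′ 9) → ∀ {i j} → f ⟨$⟩ʳ i ≡ f ⟨$⟩ʳ j → i ≡ j
perm-injective f e = trans (sym (inverseˡ f)) (trans (cong (f ⟨$⟩ˡ_) e) (inverseˡ f))

σ τ : (f : Permutation′ 9) → RespectsBlocks f → SudokuGrid → SudokuGrid
σ f r = onRows    (f ⟨$⟩ʳ_) (perm-injective f) (λ {i} {l} → Equivalence.to (r i l))
τ f r = onColumns (f ⟨$⟩ʳ_) (perm-injective f) (λ {j} {m} → Equivalence.to (r j m))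

-- The image { f d ∣ d ∈ p }: e is a member iff f⁻¹ e ∈ p (∈-image is the direct form).
image : Permutation′ 9 → Subset 9 → Subset 9
image f p = tabulate λ e → lookup p (f ⟨$⟩ˡ e)

∈-image⁺ : ∀ f p {d} → d ∈ p → f ⟨$⟩ʳ d ∈ image f p
∈-image⁺ f p {d} d∈p = lookup⇒[]= _ (image f p)
  (trans (lookup∘tabulate (λ e → lookup p (f ⟨$⟩ˡ e)) (f ⟨$⟩ʳ d))
         (trans (cong (lookup p) (inverseˡ f)) ([]=⇒lookup d∈p)))

∈-image⁻ : ∀ f p {e} → e ∈ image f p → f ⟨$⟩ˡ e ∈ p
∈-image⁻ f p {e} e∈ = lookup⇒[]= _ p
  (trans (sym (lookup∘tabulate (λ e → lookup p (f ⟨$⟩ˡ e)) e)) ([]=⇒lookup e∈))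

∈-image : ∀ f p {e} → e ∈ image f p ⇔ ∃ λ d → d ∈ p × e ≡ f ⟨$⟩ʳ d
∈-image f p = mk⇔
  (λ e∈ → _ , ∈-image⁻ f p e∈ , sym (inverseʳ f))
  (λ { (d , d∈p , refl) → ∈-image⁺ f p d∈p })

image-singleton⁻ : ∀ f p {e} → image f p ≡ ⁅ e ⁆ → p ≡ ⁅ f ⟨$⟩ˡ e ⁆
image-singleton⁻ f p {e} eq = ⊆-antisym
  (λ {d} d∈p → subst (λ x → d ∈ ⁅ x ⁆)
     (trans (sym (inverseˡ f))
            (cong (f ⟨$⟩ˡ_) (x∈⁅y⁆⇒x≡y e (subst (_ ∈_) eq (∈-image⁺ f p d∈p)))))
     (x∈⁅x⁆ d))
  (λ x∈ → subst (_∈ p) (sym (x∈⁅y⁆⇒x≡y _ x∈))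
            (∈-image⁻ f p (subst (e ∈_) (sym eq) (x∈⁅x⁆ e))))

relabel : Permutation′ 9 → SudokuGrid → SudokuGrid
relabel f A = record
  { grid = record
      { entry    = λ i j → image f (cell A i j)
      ; nonempty = λ i j → let (d , d∈) = nonempty (grid A) i j in
                           f ⟨$⟩ʳ d , ∈-image⁺ f _ d∈
      }
  ; isSudoku = λ i j d e l m ne u d∈ →
      isSudoku A i j (f ⟨$⟩ˡ d) (image-singleton⁻ f _ e) l m ne u (∈-image⁻ f _ d∈)
  }

data IsElementary : (SudokuGrid → SudokuGrid) → Set where
  is-id : IsElementary id
  is-δ  : IsElementary δ
  is-χ  : IsElementary χ
  is-χ̄  : IsElementary χ̄
  is-δ̄  : IsElementary δ̄
  is-ρ₁ : IsElementary ρ₁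
  is-ρ₂ : IsElementary ρ₂
  is-ρ₃ : IsElementary ρ₃
  is-σ  : ∀ f (r : RespectsBlocks f) → IsElementary (σ f r)
  is-τ  : ∀ f (r : RespectsBlocks f) → IsElementary (τ f r)
  is-λ  : ∀ f → IsElementary (relabel f)

-- The constructor ext makes the predicate invariant under equality of maps, which
-- is pointwise equality of matrices and not _≡_ of Agda functions.
data IsSudokuTransformation : (SudokuGrid → SudokuGrid) → Set where
  elementary : ∀ {θ} → IsElementary θ → IsSudokuTransformation θ
  compose    : ∀ {θ φ} → IsSudokuTransformation θ → IsSudokuTransformation φ →
               IsSudokuTransformation (θ ∘ φ)
  ext        : ∀ {θ φ} → (∀ A → θ A ≋ φ A) →
               IsSudokuTransformation θ → IsSudokuTransformation φ

IsAutomorphism : (SudokuGrid → SudokuGrid) → SudokuGrid → Set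
IsAutomorphism θ A = IsSudokuTransformation θ × θ A ≋ A

{-# OPTIONS --safe #-}
module Submission where

open import Defs

open import Data.Fin.Permutation using (_⟨$⟩ʳ_; inverseʳ)
open import Data.Fin.Properties using (_≟_)
open import Data.Fin.Subset using (Subset; _∈_; _⊆_; ∣_∣; ⁅_⁆)
open import Data.Fin.Subset.Properties
  using (⊆-antisym; x∈⁅x⁆; x∈⁅y⁆⇒x≡y; ∣⁅x⁆∣≡1; p⊂q⇒∣p∣<∣q∣)
open import Data.Nat.Properties using (<-irrefl)
open import Data.Product.Base using (_,_; proj₂)
open import Relation.Binary.PropositionalEquality
  using (_≡_; refl; sym; trans; cong; subst; subst₂)
open import Relation.Nullary using (yes; no; contradiction)

-- Sudoku transformations are monotone for cellwise inclusion and preserve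
-- fullness. Hence if S solves A then θ S solves θ A, which is A when θ is an
-- automorphism, and uniqueness forces θ S to be S.

PreservesSolutions : (SudokuGrid → SudokuGrid) → Set
PreservesSolutions θ = ∀ A S → IsSolution A S → IsSolution (θ A) (θ S)

-- A member `y` other than `x` would make `⁅ x ⁆` a proper subset of `p`, forcing `∣ p ∣` above 1.
∣p∣≡1⇒p≡⁅x⁆ : ∀ {n} {p : Subset n} {x} → x ∈ p → ∣ p ∣ ≡ 1 → p ≡ ⁅ x ⁆
∣p∣≡1⇒p≡⁅x⁆ {p = p} {x} x∈p ∣p∣≡1 = ⊆-antisym p⊆⁅x⁆ ⁅x⁆⊆p
  where
  ⁅x⁆⊆p : ⁅ x ⁆ ⊆ p
  ⁅x⁆⊆p y∈ = subst (_∈ p) (sym (x∈⁅y⁆⇒x≡y x y∈)) x∈p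

  p⊆⁅x⁆ : p ⊆ ⁅ x ⁆
  p⊆⁅x⁆ {y} y∈p with y ≟ x
  ... | yes refl = x∈⁅x⁆ x
  ... | no y≢x   = contradiction
    (p⊂q⇒∣p∣<∣q∣ (⁅x⁆⊆p , y , y∈p , λ y∈ → y≢x (x∈⁅y⁆⇒x≡y x y∈)))
    (<-irrefl (trans (∣⁅x⁆∣≡1 x) (sym ∣p∣≡1)))

image-mono : ∀ f {p q} → p ⊆ q → image f p ⊆ image f q
image-mono f {p} {q} p⊆q e∈ =
  -- Pull `e` back along `f`, apply the inclusion there, and push forward again.
  subst (_∈ image f q) (inverseʳ f) (∈-image⁺ f q (p⊆q (∈-image⁻ f p e∈)))

image-⁅⁆ : ∀ f x → image f ⁅ x ⁆ ≡ ⁅ f ⟨$⟩ʳ x ⁆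
image-⁅⁆ f x = ⊆-antisym
  (λ {e} e∈ → subst (_∈ ⁅ f ⟨$⟩ʳ x ⁆)
    (trans (cong (f ⟨$⟩ʳ_) (sym (x∈⁅y⁆⇒x≡y x (∈-image⁻ f ⁅ x ⁆ e∈)))) (inverseʳ f))
    (x∈⁅x⁆ (f ⟨$⟩ʳ x)))
  (λ e∈ → subst (_∈ image f ⁅ x ⁆) (sym (x∈⁅y⁆⇒x≡y _ e∈)) (∈-image⁺ f ⁅ x ⁆ (x∈⁅x⁆ x)))

-- Fullness concerns only singletons, so computing `image f ⁅ x ⁆` replaces a general argument that
-- bijections preserve cardinality.
∣image∣≡1 : ∀ f {p x} → x ∈ p → ∣ p ∣ ≡ 1 → ∣ image f p ∣ ≡ 1
∣image∣≡1 f {x = x} x∈p ∣p∣≡1 =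
  trans (cong ∣_∣ (trans (cong (image f) (∣p∣≡1⇒p≡⁅x⁆ x∈p ∣p∣≡1)) (image-⁅⁆ f x)))
        (∣⁅x⁆∣≡1 (f ⟨$⟩ʳ x))

relabel-preserves : ∀ f → PreservesSolutions (relabel f)
relabel-preserves f A S (full , S⊆A) =
    (λ i j → ∣image∣≡1 f (proj₂ (nonempty (grid S) i j)) (full i j))
  , (λ i j → image-mono f (S⊆A i j))

-- Geometric transformations and shuffles only move cells, so in those cases both
-- conditions are definitionally the hypotheses at the moved indices.
elementary-preserves : ∀ {θ} → IsElementary θ → PreservesSolutions θ
elementary-preserves is-id      A S s = s
elementary-preserves is-δ       A S (full , S⊆A) = (λ i j → full _ _) , (λ i j → S⊆A _ _)
elementary-preserves is-χ       A S (full , S⊆A) = (λ i j → full _ _) , (λ i j → S⊆A _ _)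
elementary-preserves is-χ̄      A S (full , S⊆A) = (λ i j → full _ _) , (λ i j → S⊆A _ _)
elementary-preserves is-δ̄      A S (full , S⊆A) = (λ i j → full _ _) , (λ i j → S⊆A _ _)
elementary-preserves is-ρ₁      A S (full , S⊆A) = (λ i j → full _ _) , (λ i j → S⊆A _ _)
elementary-preserves is-ρ₂      A S (full , S⊆A) = (λ i j → full _ _) , (λ i j → S⊆A _ _)
elementary-preserves is-ρ₃      A S (full , S⊆A) = (λ i j → full _ _) , (λ i j → S⊆A _ _)
elementary-preserves (is-σ _ _) A S (full , S⊆A) = (λ i j → full _ _) , (λ i j → S⊆A _ _)
elementary-preserves (is-τ _ _) A S (full , S⊆A) = (λ i j → full _ _) , (λ i j → S⊆A _ _)
elementary-preserves (is-λ f) = relabel-preserves f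

-- Both `ext` and the automorphism hypothesis give equality only cell by cell, so solutions have to
-- be transported along `_≋_`.
IsSolution-resp-≋ : ∀ A B S T → A ≋ B → S ≋ T → IsSolution A S → IsSolution B T
IsSolution-resp-≋ _ _ _ _ A≋B S≋T (full , S⊆A) =
    (λ i j → trans (cong ∣_∣ (sym (S≋T i j))) (full i j))
  , (λ i j → subst₂ _⊆_ (S≋T i j) (A≋B i j) (S⊆A i j))

-- Induction on how `θ` is built; since `PreservesSolutions` ranges over all pairs of grids, it
-- chains under composition.
transformation-preserves : ∀ {θ} → IsSudokuTransformation θ → PreservesSolutions θ
transformation-preserves (elementary e) = elementary-preserves e
transformation-preserves (compose t u) A S s =
  transformation-preserves t _ _ (transformation-preserves u A S s)
transformation-preserves (ext {θ} {φ} θ≋φ t) A S s =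
  IsSolution-resp-≋ (θ A) (φ A) (θ S) (φ S) (θ≋φ A) (θ≋φ S) (transformation-preserves t A S s)

theorem8p2 : (A S : SudokuGrid) (θ : SudokuGrid → SudokuGrid) →
    IsAutomorphism θ A → IsUniqueSolution A S → IsAutomorphism θ S
theorem8p2 A S θ (t , θA≋A) (s , unique) =
  t , unique (θ S)
    -- Only the puzzle is exchanged, `θ A` for `A`; the solution `θ S` stays fixed.
    (IsSolution-resp-≋ (θ A) A (θ S) (θ S) θA≋A (λ _ _ → refl)
      (transformation-preserves t A S s))
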